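{- For every pair $(\lambda_1,\lambda_2)$ of connected computons, there is a p-diagram $\rho$ (having $\lambda_1$ and $\lambda_2$ as the two connected computons being put in parallel) such that the p-sync computon $\lambda_1\mid_\rho\lambda_2$, i.e. the colimit of $\rho$, exists.
   Context: $\mathbf{Set}$ is the category of finite sets and total functions. A computon $\lambda$ is a tuple $(U,P,I,O,\Sigma,\sigma,\tau,t,s,c)$ (a functor into $\mathbf{Set}$ from the free category on the arrows $\sigma:O\to U$, $\tau:I\to U$, $t:O\to P$, $s:I\to P$, $c:P\to\Sigma$) where $U$ (computation units), $I$ and $O$ (edges) are possibly empty finite sets, $P$ (ports) is a non-empty finite set, $\Sigma\subset\mathbb{N}$ (colours) is finite with $0\in\Sigma$, the functions $\sigma,\tau,c$ are surjective, and: the restrictions $\sigma|_{(c\circ t)^{ -1}(0)}$ and $\tau|_{(c\circ s)^{ -1}(0)}$ are surjective onto $U$; there is $p\in P\setminus \mathrm{Im}(s)$ with $c(p)=0$; there is $q\in P\setminus \mathrm{Im}(t)$ with $c(q)=0$. Components of $\lambda_j$ carry the subscript $j$. Put $P^+=P\setminus \mathrm{Im}(t)$ (e-inports) and $P^-=P\setminus \mathrm{Im}(s)$ (e-outports). Write $p\xrightarrow{i}u$ if $s(i)=p,\ \tau(i)=u$, and $u\xrightarrow{o}p$ if $\sigma(o)=u,\ t(o)=p$. For a port $p$, $\bullet p=\{u\in U\mid \exists o\in O,\ u\xrightarrow{o}p\}$ and $p\bullet=\{u\in U\mid\exists i\in I,\ p\xrightarrow{i}u\}$. Write $p_1\xrightarrow{\exists}p_n$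 if there is a chain $p_1\xrightarrow{i_1}u_1\xrightarrow{o_1}p_2\cdots\xrightarrow{i_{n-1}}u_{n-1}\xrightarrow{o_{n-1}}p_n$ with $n\ge 2$. A computon is connected if for each $p\in \mathrm{Im}(s)\cup P^+$ there is $q\in P^-$ with $p\xrightarrow{\exists}q$. A computon morphism $\alpha:\lambda_1\to\lambda_2$ is a natural transformation (functions $\alpha_U,\alpha_P,\alpha_I,\alpha_O,\alpha_\Sigma$ commuting with $\sigma,\tau,t,s,c$) such that $\alpha_\Sigma$ is the inclusion $\Sigma_1\subseteq\Sigma_2$ and $\vec{i}(\alpha)\cup\vec{o}(\alpha)\subseteq P_1^+\cup P_1^-$, where $\vec{i}(\alpha)=\{p\in P_1\mid \bullet\alpha(p)\setminus\alpha(\bullet p)\ne\emptyset\}$ and $\vec{o}(\alpha)=\{p\in P_1\mid \alpha(p)\bullet\setminus\alpha(p\bullet)\neq\emptyset\}$. Here $\alpha(p)=\alpha_P(p)$ and $\alpha(A)$ is the image of a set $A$ of ports or units. Computons and computon morphisms form the category $\mathbf{Set}^{\mathbf{Comp}}$ (componentwise composition). In this category, colimits (when they exist) are computed componentwise in $\mathbf{Set}$ on $U,P,I,O$, with the $\Sigma$-component being the union of the colour sets and with the induced structure functions. A trivial computon is one with $U=I=O=\emptyset$; a unit computon is a trivial computon with $|P|=|\Sigma|=1$. A primitive computon is one with $|U|=1$, $s$ and $t$ injective and $P=\mathrm{Im}(s)\,\triangle\,\mathrm{Im}(t)$ (symmetric difference). A fork computon is a primitive computon with $|O|=2$, $|I|=|\Sigma|=1$;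 a join computon is a primitive computon with $|I|=2$, $|O|=|\Sigma|=1$. A span $\lambda_1\xleftarrow{\alpha_1}\lambda_0\xrightarrow{\alpha_2}\lambda_2$ of computon morphisms is sequentiable if (i) $\lambda_0$ is a trivial computon with $P_0=\vec{i}(\alpha_1)\cap\vec{o}(\alpha_2)$, (ii) $\lambda_1,\lambda_2$ are connected, (iii) $\alpha_1(\vec{o}(\alpha_2))\subseteq P_1^-$, and (iv) $\alpha_2(\vec{i}(\alpha_1))\subseteq P_2^+$. It is partially sequentiable if, moreover, at least one of the inclusions in (iii), (iv) is proper. A p-diagram $\rho$ is a diagram in $\mathbf{Set}^{\mathbf{Comp}}$ consisting of computons $\lambda_0,\dots,\lambda_7$ and morphisms $\alpha_0:\lambda_0\to\lambda_4$, $\alpha_2:\lambda_0\to\lambda_6$, $\alpha_1:\lambda_1\to\lambda_4$, $\alpha_3:\lambda_1\to\lambda_7$, $\alpha_4:\lambda_2\to\lambda_6$, $\alpha_6:\lambda_2\to\lambda_5$, $\alpha_5:\lambda_3\to\lambda_7$, $\alpha_7:\lambda_3\to\lambda_5$, where: $\lambda_0,\lambda_1,\lambda_2,\lambda_3$ are unit computons; $\lambda_4,\lambda_5$ are connected computons; $\lambda_6$ is a fork computon; $\lambda_7$ is a join computon; the spans $\lambda_6\xleftarrow{\alpha_2}\lambda_0\xrightarrow{\alpha_0}\lambda_4$, $\lambda_4\xleftarrow{\alpha_1}\lambda_1\xrightarrow{\alpha_3}\lambda_7$, $\lambda_5\xleftarrow{\alpha_7}\lambda_3\xrightarrow{\alpha_5}\lambda_7$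 and $\lambda_6\xleftarrow{\alpha_4}\lambda_2\xrightarrow{\alpha_6}\lambda_5$ are partially sequentiable; $\alpha_2(P_0)\ne\alpha_4(P_2)$; and $\alpha_3(P_1)\neq\alpha_5(P_3)$. A p-sync computon is the colimit of a p-diagram; with this labelling it is written $\lambda_4\mid_\rho\lambda_5$. (The labels used in this definition of a p-diagram are independent of the labels $\lambda_1,\lambda_2$ in the claim, which play the roles of $\lambda_4,\lambda_5$.)
   Formalization: The colimit is the componentwise one: each cocone of computon morphisms factors uniquely through it by a natural map that is the inclusion on colours, not required to satisfy the i⃗/o⃗ condition of a computon morphism; with that condition no such colimit exists. -}

module Defs where

open import Level using (0ℓ)
open import Data.Nat.Base using (ℕ)
open import Data.Fin.Base using (Fin)
open import Data.Fin.Patterns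
open import Data.List.Base using (List)
import Data.List.Membership.Propositional as List
open import Data.Product.Base using (∃; ∃-syntax; _×_; _,_)
open import Data.Product using (∃!)
open import Data.Sum.Base using (_⊎_)
open import Function.Base using (_∘_)
open import Function.Bundles using (_↔_)
open import Function.Definitions using (Injective; StrictlySurjective)
open import Relation.Binary.Construct.Closure.Transitive using (TransClosure)
open import Relation.Binary.PropositionalEquality.Core using (_≡_; _≗_)
open import Relation.Nullary.Negation.Core using (¬_)
open import Relation.Unary
  using (Pred; _∈_; _∉_; _⊆_; _⊂_; _≐_; _∩_; _∪_; _∖_; ∁; ｛_｝; ⋃; Universal; Satisfiable)

------------------------------------------------------------------------
-- Finite sets and images

HasCardinality : Set → ℕ → Set
HasCardinality A n = A ↔ Fin n

Finite : Set → Set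
Finite A = ∃[ n ] HasCardinality A n

FiniteSubset : {A : Set} → Pred A 0ℓ → Set
FiniteSubset S = ∃[ xs ] S ≐ (List._∈ xs)

Im : {A B : Set} → (A → B) → Pred B 0ℓ
Im f y = ∃[ x ] f x ≡ y

infix 8 _[_]
_[_] : {A B : Set} → (A → B) → Pred A 0ℓ → Pred B 0ℓ
(f [ S ]) y = ∃[ x ] x ∈ S × f x ≡ y

infixr 6 _△_
_△_ : {A : Set} → Pred A 0ℓ → Pred A 0ℓ → Pred A 0ℓ
S △ T = (S ∖ T) ∪ (T ∖ S)

------------------------------------------------------------------------
-- Computons

-- The set Σ of colours is the subset Colour of ℕ, and the function
-- c : P → Σ is an ℕ-valued function together with c-colour.
record Computon : Set₁ where
  field
    U P I O : Set
    Colour  : Pred ℕ 0ℓ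

    U-finite      : Finite U
    P-finite      : Finite P
    I-finite      : Finite I
    O-finite      : Finite O
    Colour-finite : FiniteSubset Colour
    P-nonempty    : P
    0-colour      : 0 ∈ Colour

    σ : O → U
    τ : I → U
    t : O → P
    s : I → P
    c : P → ℕ

    c-colour     : ∀ p → c p ∈ Colour
    σ-surjective : StrictlySurjective _≡_ σ
    τ-surjective : StrictlySurjective _≡_ τ
    c-surjective : ∀ {k} → k ∈ Colour → ∃[ p ] c p ≡ k

    σ-surjective₀ : ∀ u → ∃[ o ] c (t o) ≡ 0 × σ o ≡ u
    τ-surjective₀ : ∀ u → ∃[ i ] c (s i) ≡ 0 × τ i ≡ u

    outport₀ : ∃[ p ] p ∉ Im s × c p ≡ 0
    inport₀  : ∃[ q ] q ∉ Im t × c q ≡ 0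

  P⁺ : Pred P 0ℓ
  P⁺ = ∁ (Im t)

  P⁻ : Pred P 0ℓ
  P⁻ = ∁ (Im s)

  _—[_]→ᵘ_ : P → I → U → Set
  p —[ i ]→ᵘ u = s i ≡ p × τ i ≡ u

  _—[_]→ᵖ_ : U → O → P → Set
  u —[ o ]→ᵖ p = σ o ≡ u × t o ≡ p

  infix 9 •_ _•
  •_ : P → Pred U 0ℓ
  (• p) u = ∃[ o ] u —[ o ]→ᵖ p

  _• : P → Pred U 0ℓ
  (p •) u = ∃[ i ] p —[ i ]→ᵘ u

  Step : P → P → Set
  Step p q = ∃[ i ] ∃[ u ] ∃[ o ] (p —[ i ]→ᵘ u) × (u —[ o ]→ᵖ q)

  infix 4 _↝_
  _↝_ : P → P → Set
  _↝_ = TransClosure Step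

open Computon

Connected : Computon → Set
Connected L = ∀ {p} → p ∈ Im (s L) ∪ P⁺ L → ∃[ q ] q ∈ P⁻ L × _↝_ L p q

------------------------------------------------------------------------
-- Morphisms

-- The component at Σ is forced to be the inclusion, so its
-- naturality square says that colours are preserved (c-natural).
infix 4 _⇒ⁿ_ _⇒_
record _⇒ⁿ_ (L M : Computon) : Set where
  field
    onU : U L → U M
    onP : P L → P M
    onI : I L → I M
    onO : O L → O M
    inclusion : Colour L ⊆ Colour M

    σ-natural : ∀ o → onU (σ L o) ≡ σ M (onO o)
    τ-natural : ∀ i → onU (τ L i) ≡ τ M (onI i)
    t-natural : ∀ o → onP (t L o) ≡ t M (onO o)
    s-natural : ∀ i → onP (s L i) ≡ s M (onI i)
    c-natural : ∀ p → c L p ≡ c M (onP p)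

open _⇒ⁿ_

module _ {L M : Computon} where

  i⃗ : L ⇒ⁿ M → Pred (P L) 0ℓ
  i⃗ α p = Satisfiable ((•_ M (onP α p)) ∖ (onU α [ •_ L p ]))

  o⃗ : L ⇒ⁿ M → Pred (P L) 0ℓ
  o⃗ α p = Satisfiable ((_• M (onP α p)) ∖ (onU α [ _• L p ]))

record _⇒_ (L M : Computon) : Set where
  field
    natural  : L ⇒ⁿ M
    boundary : i⃗ natural ∪ o⃗ natural ⊆ P⁺ L ∪ P⁻ L

  open _⇒ⁿ_ natural public

open _⇒_ using (natural)

-- h ∘ α = β, componentwise and pointwise (the Σ-components always agree).
Factors : {K L M : Computon} → L ⇒ⁿ M → K ⇒ⁿ L → K ⇒ⁿ M → Set
Factors h α β =
  (onU h ∘ onU α ≗ onU β) × (onP h ∘ onP α ≗ onP β) ×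
  (onI h ∘ onI α ≗ onI β) × (onO h ∘ onO α ≗ onO β)

_≈_ : {L M : Computon} → L ⇒ⁿ M → L ⇒ⁿ M → Set
α ≈ β = (onU α ≗ onU β) × (onP α ≗ onP β) × (onI α ≗ onI β) × (onO α ≗ onO β)

------------------------------------------------------------------------
-- Special computons and spans

Trivial : Computon → Set
Trivial L = ¬ U L × ¬ I L × ¬ O L

Unit : Computon → Set
Unit L = Trivial L × HasCardinality (P L) 1 × ∃[ k ] Colour L ≐ ｛ k ｝

Primitive : Computon → Set
Primitive L =
  HasCardinality (U L) 1 × Injective _≡_ _≡_ (s L) × Injective _≡_ _≡_ (t L) ×
  Universal (Im (s L) △ Im (t L))

Fork : Computon → Set
Fork L =
  Primitive L × HasCardinality (O L) 2 × HasCardinality (I L) 1 ×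
  ∃[ k ] Colour L ≐ ｛ k ｝

Join : Computon → Set
Join L =
  Primitive L × HasCardinality (I L) 2 × HasCardinality (O L) 1 ×
  ∃[ k ] Colour L ≐ ｛ k ｝

module _ {L₀ L₁ L₂ : Computon} where

  record Sequentiable (α₁ : L₀ ⇒ L₁) (α₂ : L₀ ⇒ L₂) : Set where
    field
      trivial    : Trivial L₀
      ports      : Universal (i⃗ (natural α₁) ∩ o⃗ (natural α₂))
      connected₁ : Connected L₁
      connected₂ : Connected L₂
      outports   : _⇒_.onP α₁ [ o⃗ (natural α₂) ] ⊆ P⁻ L₁
      inports    : _⇒_.onP α₂ [ i⃗ (natural α₁) ] ⊆ P⁺ L₂

  PartiallySequentiable : L₀ ⇒ L₁ → L₀ ⇒ L₂ → Set
  PartiallySequentiable α₁ α₂ = Sequentiable α₁ α₂ ×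
    ( (_⇒_.onP α₁ [ o⃗ (natural α₂) ] ⊂ P⁻ L₁)
    ⊎ (_⇒_.onP α₂ [ i⃗ (natural α₁) ] ⊂ P⁺ L₂) )

------------------------------------------------------------------------
-- Colimits

record Shape : Set₁ where
  field
    Node Edge : Set
    src tgt   : Edge → Node

open Shape

module _ {J : Shape} where

  module _ (obj : Node J → Set) (arr : ∀ e → obj (src J e) → obj (tgt J e)) where

    IsCocone : {X : Set} → (∀ j → obj j → X) → Set
    IsCocone κ = ∀ e → κ (tgt J e) ∘ arr e ≗ κ (src J e)

    -- Colimits in the category of finite sets.
    IsSetColimit : (X : Set) → (∀ j → obj j → X) → Set₁
    IsSetColimit X ι = IsCocone ι ×
      (∀ {Y : Set} → Finite Y → (κ : ∀ j → obj j → Y) → IsCocone κ →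
        ∃! _≗_ λ (h : X → Y) → ∀ j → h ∘ ι j ≗ κ j)

record Diagram (J : Shape) : Set₁ where
  field
    obj : Node J → Computon
    arr : ∀ e → obj (src J e) ⇒ obj (tgt J e)

module _ {J : Shape} (D : Diagram J) where
  open Diagram D

  Cocone : (L : Computon) → (∀ j → obj j ⇒ L) → Set
  Cocone L κ = ∀ e →
    Factors (natural (κ (tgt J e))) (natural (arr e)) (natural (κ (src J e)))

  -- A colimit is computed componentwise: U, P, I, O are colimits of finite
  -- sets and the colours are the union; naturality of the legs then makes
  -- σ, τ, t, s, c the induced functions.  The object and its legs live in the
  -- category of computons, and every cocone of computon morphisms factors
  -- uniquely, but, as in the functor category, the mediating arrow is only
  -- asked to be natural.  Asking it to satisfy boundary as well would leave
  -- even sequentiable spans without pushouts: a port obtained by gluing an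
  -- e-outport to an e-inport is internal to the gluing, whereas a cocone may
  -- send it to a port with further producers or consumers, as boundary allows
  -- for each of its legs.
  record IsColimit (L : Computon) (ι : ∀ j → obj j ⇒ L) : Set₁ where
    field
      cocone : Cocone L ι

      universal : ∀ {M} (κ : ∀ j → obj j ⇒ M) → Cocone M κ →
        ∃! _≈_ λ (h : L ⇒ⁿ M) → ∀ j → Factors h (natural (ι j)) (natural (κ j))

      U-colimit : IsSetColimit {J} (λ j → U (obj j)) (λ e → _⇒_.onU (arr e)) (U L) (λ j → _⇒_.onU (ι j))
      P-colimit : IsSetColimit {J} (λ j → P (obj j)) (λ e → _⇒_.onP (arr e)) (P L) (λ j → _⇒_.onP (ι j))
      I-colimit : IsSetColimit {J} (λ j → I (obj j)) (λ e → _⇒_.onI (arr e)) (I L) (λ j → _⇒_.onI (ι j))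
      O-colimit : IsSetColimit {J} (λ j → O (obj j)) (λ e → _⇒_.onO (arr e)) (O L) (λ j → _⇒_.onO (ι j))
      Colour-union : Colour L ≐ ⋃ (Node J) (λ j → Colour (obj j))

  record Colimit : Set₁ where
    field
      apex      : Computon
      legs      : ∀ j → obj j ⇒ apex
      isColimit : IsColimit apex legs

------------------------------------------------------------------------
-- p-diagrams

-- The edges are numbered as α₀, …, α₇ below.
pShape : Shape
pShape = record { Node = Fin 8 ; Edge = Fin 8 ; src = source ; tgt = target }
  where
  source target : Fin 8 → Fin 8
  source 0F = 0F
  source 1F = 1F
  source 2F = 0F
  source 3F = 1F
  source 4F = 2F
  source 5F = 3F
  source 6F = 2F
  source 7F = 3F
  target 0F = 4F
  target 1F = 4F
  target 2F = 6F
  target 3F = 7F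
  target 4F = 6F
  target 5F = 7F
  target 6F = 5F
  target 7F = 5F

record PDiagram (L₄ L₅ : Computon) : Set₁ where
  field
    {L₀ L₁ L₂ L₃ L₆ L₇} : Computon

    α₀ : L₀ ⇒ L₄
    α₂ : L₀ ⇒ L₆
    α₁ : L₁ ⇒ L₄
    α₃ : L₁ ⇒ L₇
    α₄ : L₂ ⇒ L₆
    α₆ : L₂ ⇒ L₅
    α₅ : L₃ ⇒ L₇
    α₇ : L₃ ⇒ L₅

    unit₀ : Unit L₀
    unit₁ : Unit L₁
    unit₂ : Unit L₂
    unit₃ : Unit L₃
    connected₄ : Connected L₄
    connected₅ : Connected L₅
    fork₆ : Fork L₆
    join₇ : Join L₇

    span₀ : PartiallySequentiable α₂ α₀
    span₁ : PartiallySequentiable α₁ α₃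
    span₃ : PartiallySequentiable α₇ α₅
    span₂ : PartiallySequentiable α₄ α₆

    fork-distinct : ¬ (Im (_⇒_.onP α₂) ≐ Im (_⇒_.onP α₄))
    join-distinct : ¬ (Im (_⇒_.onP α₃) ≐ Im (_⇒_.onP α₅))

  diagram : Diagram pShape
  diagram = record { obj = object ; arr = arrow }
    where
    object : Fin 8 → Computon
    object 0F = L₀
    object 1F = L₁
    object 2F = L₂
    object 3F = L₃
    object 4F = L₄
    object 5F = L₅
    object 6F = L₆
    object 7F = L₇

    arrow : ∀ e → object (src pShape e) ⇒ object (tgt pShape e)
    arrow 0F = α₀
    arrow 1F = α₁
    arrow 2F = α₂
    arrow 3F = α₃
    arrow 4F = α₄
    arrow 5F = α₅
    arrow 6F = α₆
    arrow 7F = α₇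

PSync : {L₁ L₂ : Computon} → PDiagram L₁ L₂ → Set₁
PSync ρ = Colimit (PDiagram.diagram ρ)

{-# OPTIONS --safe #-}
-- Glue the two outputs of a fork to colour-0 e-inports a of λ₁ and a′ of λ₂, and
-- the two inputs of a join to colour-0 e-outports b of λ₁ and b′ of λ₂.
-- Connectedness makes a and a′ be consumed and b and b′ be produced, so all
-- spans are partially sequentiable.  Every port of the fork and of the join but
-- one is glued to a port of λ₁ or λ₂, so the colimit needs no quotient: its
-- ports are those of λ₁ and λ₂ plus the input of the fork and the output of
-- the join.
module Submission where

open import Level using (0ℓ)
open import Data.Empty using (⊥; ⊥-elim)
open import Data.Fin.Base using (Fin; suc)
open import Data.Fin.Patterns
open import Data.Fin.Properties using (any?; suc-injective; +↔⊎)
import Data.Fin.Properties as Fin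
open import Data.List.Base using ([]; _∷_; _++_)
open import Data.List.Membership.Propositional.Properties
  using (∈-++⁺ˡ; ∈-++⁺ʳ; ∈-++⁻)
open import Data.List.Relation.Unary.Any using (here)
open import Data.Nat.Base using (ℕ; _+_)
open import Data.Product.Base using (Σ-syntax; ∃-syntax; _×_; _,_; proj₁; proj₂)
open import Data.Sum.Base using (_⊎_; inj₁; inj₂; map; swap) renaming ([_,_] to either)
open import Data.Sum.Function.Propositional using (_⊎-↔_)
open import Data.Sum.Properties using (inj₁-injective; inj₂-injective)
open import Function.Base using (_∘_; id)
open import Function.Bundles using (Inverse)
open import Function.Construct.Identity using (↔-id)
open import Function.Properties.Inverse using (↔-sym; ↔-trans)
open import Relation.Binary.Construct.Closure.Transitive using ([_]; _∷_)
open import Relation.Binary.PropositionalEquality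
  using (_≡_; _≢_; _≗_; refl; sym; trans; cong)
open import Relation.Nullary.Decidable using (Dec; yes; no; map′)
open import Relation.Unary using (Pred; _∈_; _∉_; _∪_; _≐_; ｛_｝; ⋃; Universal; Satisfiable)

open import Defs

open Computon
open _⇒ⁿ_
open _⇒_ using (natural)

-- Finite sets and decidable images.

Fin-finite : ∀ {n} → Finite (Fin n)
Fin-finite = _ , ↔-id _

⊎-finite : ∀ {A B} → Finite A → Finite B → Finite (A ⊎ B)
⊎-finite (m , A↔m) (n , B↔n) =
  m + n , ↔-trans (A↔m ⊎-↔ B↔n) (↔-sym +↔⊎)

∪-finite : ∀ {A : Set} {S T : Pred A 0ℓ} →
           FiniteSubset S → FiniteSubset T → FiniteSubset (S ∪ T)
∪-finite (xs , S⊆xs , xs⊆S) (ys , T⊆ys , ys⊆T) = xs ++ ys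
  , either (λ x∈S → ∈-++⁺ˡ (S⊆xs x∈S)) (λ x∈T → ∈-++⁺ʳ xs (T⊆ys x∈T))
  , λ x∈ → map xs⊆S ys⊆T (∈-++⁻ xs x∈)

singleton-finite : ∀ {A : Set} (x : A) → FiniteSubset ｛ x ｝
singleton-finite x = x ∷ [] , (λ { refl → here refl }) , λ { (here refl) → refl }

-- Transporting `f` along both bijections turns the question into a search through `Fin` for an
-- equality in `Fin`. It supplies the case split in `connected⇒produced` constructively.
Im? : ∀ {A B} → Finite A → Finite B → (f : A → B) → ∀ y → Dec (Im f y)
Im? (_ , A↔m) (_ , B↔n) f y =
  map′ (λ (k , e) → A.from k , B-injective e)
       (λ { (x , refl) → A.to x , cong (B.to ∘ f) (A.strictlyInverseʳ x) })
       (any? λ k → B.to (f (A.from k)) Fin.≟ B.to y)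
  where
  module A = Inverse A↔m
  module B = Inverse B↔n

  B-injective : ∀ {x y} → B.to x ≡ B.to y → x ≡ y
  B-injective {x} {y} e =
    trans (sym (B.strictlyInverseʳ x)) (trans (cong B.from e) (B.strictlyInverseʳ y))

-- Componentwise colimits

module _ {J : Shape} where

  open Shape J

  -- A form of the set-level universal property that is convenient to check: existence is an
  -- explicit function `glue`, and uniqueness is traded for joint surjectivity of the legs
  -- (`covering`).
  record Gluing (obj : Node → Set) (arr : ∀ e → obj (src e) → obj (tgt e))
                (X : Set) (ι : ∀ j → obj j → X) : Set₁ where
    field
      cocone   : IsCocone obj arr ι
      glue     : ∀ {Y : Set} (κ : ∀ j → obj j → Y) → IsCocone obj arr κ → X → Y
      glue-ι   : ∀ {Y : Set} (κ : ∀ j → obj j → Y) (κ-cocone : IsCocone obj arr κ) →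
                 ∀ j → glue κ κ-cocone ∘ ι j ≗ κ j
      covering : ∀ x → ∃[ j ] ∃[ y ] ι j y ≡ x

    jointly-epic : ∀ {Y : Set} {g h : X → Y} → (∀ j → g ∘ ι j ≗ h ∘ ι j) → g ≗ h
    jointly-epic g≗h x with covering x
    ... | j , y , refl = g≗h j y

    glue-unique : ∀ {Y : Set} (κ : ∀ j → obj j → Y) (κ-cocone : IsCocone obj arr κ) →
                  ∀ {h : X → Y} → (∀ j → h ∘ ι j ≗ κ j) → glue κ κ-cocone ≗ h
    glue-unique κ κ-cocone h∘ι = jointly-epic λ j y →
      trans (glue-ι κ κ-cocone j y) (sym (h∘ι j y))

    isSetColimit : IsSetColimit {J} obj arr X ι
    isSetColimit = cocone , λ _ κ κ-cocone →
      glue κ κ-cocone , glue-ι κ κ-cocone , glue-unique κ κ-cocone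

  module _ (D : Diagram J) (L : Computon) (ι : ∀ j → Diagram.obj D j ⇒ L) where
    open Diagram D

    -- The four glued functions commute with the structure maps because both sides of each
    -- naturality square agree after precomposition with every leg, and the legs are jointly epic.
    componentwise :
      Gluing (λ j → U (obj j)) (λ e → onU (natural (arr e))) (U L) (λ j → onU (natural (ι j))) →
      Gluing (λ j → P (obj j)) (λ e → onP (natural (arr e))) (P L) (λ j → onP (natural (ι j))) →
      Gluing (λ j → I (obj j)) (λ e → onI (natural (arr e))) (I L) (λ j → onI (natural (ι j))) →
      Gluing (λ j → O (obj j)) (λ e → onO (natural (arr e))) (O L) (λ j → onO (natural (ι j))) →
      Colour L ≐ ⋃ Node (λ j → Colour (obj j)) →
      IsColimit D L ι
    componentwise gU gP gI gO colours = record
      { cocone       = λ e → GU.cocone e , GP.cocone e , GI.cocone e , GO.cocone e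
      ; universal    = λ κ κ-cocone →
          mediator κ κ-cocone , mediator-factors κ κ-cocone , λ h-factors →
            GU.glue-unique _ (λ e → proj₁ (κ-cocone e)) (λ j → proj₁ (h-factors j))
          , GP.glue-unique _ (λ e → proj₁ (proj₂ (κ-cocone e))) (λ j → proj₁ (proj₂ (h-factors j)))
          , GI.glue-unique _ (λ e → proj₁ (proj₂ (proj₂ (κ-cocone e))))
              (λ j → proj₁ (proj₂ (proj₂ (h-factors j))))
          , GO.glue-unique _ (λ e → proj₂ (proj₂ (proj₂ (κ-cocone e))))
              (λ j → proj₂ (proj₂ (proj₂ (h-factors j))))
      ; U-colimit    = GU.isSetColimit
      ; P-colimit    = GP.isSetColimit
      ; I-colimit    = GI.isSetColimit
      ; O-colimit    = GO.isSetColimit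
      ; Colour-union = colours
      }
      where
      module GU = Gluing gU
      module GP = Gluing gP
      module GI = Gluing gI
      module GO = Gluing gO

      module _ {M : Computon} (κ : ∀ j → obj j ⇒ M) (κ-cocone : Cocone D M κ) where

        hU : U L → U M
        hU = GU.glue (λ j → onU (natural (κ j))) (λ e → proj₁ (κ-cocone e))

        hP : P L → P M
        hP = GP.glue (λ j → onP (natural (κ j))) (λ e → proj₁ (proj₂ (κ-cocone e)))

        hI : I L → I M
        hI = GI.glue (λ j → onI (natural (κ j))) (λ e → proj₁ (proj₂ (proj₂ (κ-cocone e))))

        hO : O L → O M
        hO = GO.glue (λ j → onO (natural (κ j))) (λ e → proj₂ (proj₂ (proj₂ (κ-cocone e))))

        hU-ι : ∀ j → hU ∘ onU (natural (ι j)) ≗ onU (natural (κ j))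
        hU-ι = GU.glue-ι _ _

        hP-ι : ∀ j → hP ∘ onP (natural (ι j)) ≗ onP (natural (κ j))
        hP-ι = GP.glue-ι _ _

        hI-ι : ∀ j → hI ∘ onI (natural (ι j)) ≗ onI (natural (κ j))
        hI-ι = GI.glue-ι _ _

        hO-ι : ∀ j → hO ∘ onO (natural (ι j)) ≗ onO (natural (κ j))
        hO-ι = GO.glue-ι _ _

        -- One naturality square, chased on the image of a leg: naturality of the leg, factorisation
        -- at the source, naturality of the cocone, and factorisation under `f`.
        paste : ∀ {A B : Set} (h : A → B) {C : Set} (f : C → B) {x y z u v} →
                x ≡ y → h x ≡ z → z ≡ f u → v ≡ u → h y ≡ f v
        paste h f refl hx≡z z≡fu v≡u = trans hx≡z (trans z≡fu (cong f (sym v≡u)))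

        mediator : L ⇒ⁿ M
        mediator = record
          { onU       = hU
          ; onP       = hP
          ; onI       = hI
          ; onO       = hO
          ; inclusion = λ k∈L → let j , k∈j = proj₁ colours k∈L in inclusion (natural (κ j)) k∈j
          ; σ-natural = GO.jointly-epic λ j x → paste hU (σ M)
              (σ-natural (natural (ι j)) x) (hU-ι j (σ (obj j) x))
              (σ-natural (natural (κ j)) x) (hO-ι j x)
          ; τ-natural = GI.jointly-epic λ j x → paste hU (τ M)
              (τ-natural (natural (ι j)) x) (hU-ι j (τ (obj j) x))
              (τ-natural (natural (κ j)) x) (hI-ι j x)
          ; t-natural = GO.jointly-epic λ j x → paste hP (t M)
              (t-natural (natural (ι j)) x) (hP-ι j (t (obj j) x))
              (t-natural (natural (κ j)) x) (hO-ι j x)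
          ; s-natural = GI.jointly-epic λ j x → paste hP (s M)
              (s-natural (natural (ι j)) x) (hP-ι j (s (obj j) x))
              (s-natural (natural (κ j)) x) (hI-ι j x)
          -- The component at colours is an inclusion, so `id` takes the place of `h`.
          ; c-natural = GP.jointly-epic λ j x → paste id (c M)
              (c-natural (natural (ι j)) x) refl (c-natural (natural (κ j)) x) (hP-ι j x)
          }

        mediator-factors : ∀ j → Factors mediator (natural (ι j)) (natural (κ j))
        mediator-factors j = hU-ι j , hP-ι j , hI-ι j , hO-ι j

-- Points, forks and joins

unitComputon : Computon
unitComputon = record
  { U = Fin 0 ; P = Fin 1 ; I = Fin 0 ; O = Fin 0 ; Colour = ｛ 0 ｝
  ; U-finite = Fin-finite ; P-finite = Fin-finite ; I-finite = Fin-finite ; O-finite = Fin-finite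
  ; Colour-finite = singleton-finite 0
  ; P-nonempty = 0F ; 0-colour = refl
  ; σ = λ () ; τ = λ () ; t = λ () ; s = λ () ; c = λ _ → 0
  ; c-colour = λ _ → refl
  ; σ-surjective = λ () ; τ-surjective = λ () ; c-surjective = λ { refl → 0F , refl }
  ; σ-surjective₀ = λ () ; τ-surjective₀ = λ ()
  ; outport₀ = 0F , (λ ()) , refl ; inport₀ = 0F , (λ ()) , refl
  }

unitComputon-unit : Unit unitComputon
unitComputon-unit = ((λ ()) , (λ ()) , (λ ())) , ↔-id _ , 0 , id , id

-- Port 0 is the input and ports 1 and 2 are the outputs, so output edge `o` ends in port `suc o`.
forkComputon : Computon
forkComputon = record
  { U = Fin 1 ; P = Fin 3 ; I = Fin 1 ; O = Fin 2 ; Colour = ｛ 0 ｝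
  ; U-finite = Fin-finite ; P-finite = Fin-finite ; I-finite = Fin-finite ; O-finite = Fin-finite
  ; Colour-finite = singleton-finite 0
  ; P-nonempty = 0F ; 0-colour = refl
  ; σ = λ _ → 0F ; τ = λ _ → 0F ; t = suc ; s = λ _ → 0F ; c = λ _ → 0
  ; c-colour = λ _ → refl
  ; σ-surjective = λ { 0F → 0F , refl } ; τ-surjective = λ { 0F → 0F , refl }
  ; c-surjective = λ { refl → 0F , refl }
  ; σ-surjective₀ = λ { 0F → 0F , refl , refl } ; τ-surjective₀ = λ { 0F → 0F , refl , refl }
  ; outport₀ = 1F , (λ ()) , refl ; inport₀ = 0F , (λ ()) , refl
  }

-- Edge reversal: the axioms are symmetric under exchanging (σ, t) with (τ, s). It is used to obtain
-- the join from the fork.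
opposite : Computon → Computon
opposite L = record
  { U = U L ; P = P L ; I = O L ; O = I L ; Colour = Colour L
  ; U-finite = U-finite L ; P-finite = P-finite L ; I-finite = O-finite L ; O-finite = I-finite L
  ; Colour-finite = Colour-finite L
  ; P-nonempty = P-nonempty L ; 0-colour = 0-colour L
  ; σ = τ L ; τ = σ L ; t = s L ; s = t L ; c = c L
  ; c-colour = c-colour L
  ; σ-surjective = τ-surjective L ; τ-surjective = σ-surjective L ; c-surjective = c-surjective L
  ; σ-surjective₀ = τ-surjective₀ L ; τ-surjective₀ = σ-surjective₀ L
  ; outport₀ = inport₀ L ; inport₀ = outport₀ L
  }

joinComputon : Computon
joinComputon = opposite forkComputon

fork-primitive : Primitive forkComputon
fork-primitive = ↔-id _ , (λ { {0F} {0F} _ → refl }) , suc-injective , λ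
  { 0F      → inj₁ ((0F , refl) , λ ())
  ; (suc o) → inj₂ ((o , refl) , λ ())
  }

opposite-primitive : ∀ {L} → Primitive L → Primitive (opposite L)
opposite-primitive (u , s-injective , t-injective , s△t) =
  u , t-injective , s-injective , λ p → swap (s△t p)

forkComputon-fork : Fork forkComputon
forkComputon-fork = fork-primitive , ↔-id _ , ↔-id _ , 0 , id , id

joinComputon-join : Join joinComputon
joinComputon-join = opposite-primitive {forkComputon} fork-primitive , ↔-id _ , ↔-id _ , 0 , id , id

fork-connected : Connected forkComputon
fork-connected {0F}    _            = 1F , (λ ()) , [ 0F , 0F , 0F , (refl , refl) , refl , refl ]
-- An output is consumed by no edge, and it is not an e-inport because `o` produces it.
fork-connected {suc o} (inj₂ ∉Im-t) = ⊥-elim (∉Im-t (o , refl))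

join-connected : Connected joinComputon
join-connected {0F}    (inj₂ ∉Im-t) = ⊥-elim (∉Im-t (0F , refl))
join-connected {suc i} _            = 0F , (λ ()) , [ i , 0F , 0F , (refl , refl) , refl , refl ]

-- Each port misses the image of `s` or that of `t`. Hence any natural transformation out of a
-- primitive computon satisfies `boundary`.
primitive-boundary : ∀ {L} → Primitive L → Universal (P⁺ L ∪ P⁻ L)
primitive-boundary (_ , _ , _ , s△t) p = map proj₂ proj₂ (s△t p)

point : (L : Computon) (p : P L) → c L p ≡ 0 → unitComputon ⇒ L
point L p cp≡0 = record
  { natural = record
    { onU = λ () ; onP = λ _ → p ; onI = λ () ; onO = λ ()
    ; inclusion = λ { refl → 0-colour L }
    ; σ-natural = λ () ; τ-natural = λ () ; t-natural = λ () ; s-natural = λ ()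
    ; c-natural = λ _ → sym cp≡0
    }
  ; boundary = λ _ → inj₁ λ ()
  }

-- The first step of the chain from `p` to an e-outport consumes `p`.
connected⇒consumed : ∀ {L p} → Connected L → p ∈ P⁺ L → Satisfiable (_• L p)
connected⇒consumed conn p∈P⁺ with conn (inj₂ p∈P⁺)
... | _ , _ , [ i , u , _ , p→u , _ ]     = u , i , p→u
... | _ , _ , (i , u , _ , p→u , _) ∷ _   = u , i , p→u

-- Were `p` not produced, it would be an e-inport and hence consumed, contradicting that it is an
-- e-outport.
connected⇒produced : ∀ {L p} → Connected L → p ∈ P⁻ L → Satisfiable (•_ L p)
connected⇒produced {L} {p} conn p∈P⁻ with Im? (O-finite L) (P-finite L) (t L) p
... | yes (o , to≡p) = σ L o , o , refl , to≡p
... | no p∈P⁺ with connected⇒consumed {L} conn p∈P⁺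
...   | _ , i , si≡p , _ = ⊥-elim (p∈P⁻ (i , si≡p))

-- The port of a unit computon has no producers or consumers of its own, so the `ports` condition
-- just asks that `p` be produced in `L` and `q` consumed in `M`.
points-sequentiable :
  ∀ {L M p q} (cp≡0 : c L p ≡ 0) (cq≡0 : c M q ≡ 0) → Connected L → Connected M →
  p ∈ P⁻ L → q ∈ P⁺ M → Sequentiable (point L p cp≡0) (point M q cq≡0)
points-sequentiable {L} {M} _ _ connL connM p∈P⁻ q∈P⁺ = record
  { trivial    = proj₁ unitComputon-unit
  ; ports      = λ _ →
      (let u , u∈•p = connected⇒produced {L} connL p∈P⁻ in u , u∈•p , λ ())
    , (let u , u∈q• = connected⇒consumed {M} connM q∈P⁺ in u , u∈q• , λ ())
  ; connected₁ = connL
  ; connected₂ = connM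
  ; outports   = λ { (_ , _ , refl) → p∈P⁻ }
  ; inports    = λ { (_ , _ , refl) → q∈P⁺ }
  }

-- Parallel synchronisation

pattern in₁ x = inj₁ x
pattern in₂ x = inj₂ (inj₁ x)
pattern in₃ x = inj₂ (inj₂ (inj₁ x))
pattern in₄ x = inj₂ (inj₂ (inj₂ x))

module Parallel (L M : Computon) (connL : Connected L) (connM : Connected M) where

  private
    F G : Computon
    F = forkComputon
    G = joinComputon

  -- The glued ports and the p-diagram.

  a : P L
  a = proj₁ (inport₀ L)

  a∈P⁺ : a ∈ P⁺ L
  a∈P⁺ = proj₁ (proj₂ (inport₀ L))

  ca≡0 : c L a ≡ 0
  ca≡0 = proj₂ (proj₂ (inport₀ L))

  b : P L
  b = proj₁ (outport₀ L)

  b∈P⁻ : b ∈ P⁻ L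
  b∈P⁻ = proj₁ (proj₂ (outport₀ L))

  cb≡0 : c L b ≡ 0
  cb≡0 = proj₂ (proj₂ (outport₀ L))

  a′ : P M
  a′ = proj₁ (inport₀ M)

  a′∈P⁺ : a′ ∈ P⁺ M
  a′∈P⁺ = proj₁ (proj₂ (inport₀ M))

  ca′≡0 : c M a′ ≡ 0
  ca′≡0 = proj₂ (proj₂ (inport₀ M))

  b′ : P M
  b′ = proj₁ (outport₀ M)

  b′∈P⁻ : b′ ∈ P⁻ M
  b′∈P⁻ = proj₁ (proj₂ (outport₀ M))

  cb′≡0 : c M b′ ≡ 0
  cb′≡0 = proj₂ (proj₂ (outport₀ M))

  ρ : PDiagram L M
  ρ = record
    { α₀ = point L a ca≡0
    ; α₂ = point F 1F refl
    ; α₁ = point L b cb≡0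
    ; α₃ = point G 1F refl
    ; α₄ = point F 2F refl
    ; α₆ = point M a′ ca′≡0
    ; α₅ = point G 2F refl
    ; α₇ = point M b′ cb′≡0
    ; unit₀ = unitComputon-unit
    ; unit₁ = unitComputon-unit
    ; unit₂ = unitComputon-unit
    ; unit₃ = unitComputon-unit
    ; connected₄ = connL
    ; connected₅ = connM
    ; fork₆ = forkComputon-fork
    ; join₇ = joinComputon-join
    ; span₀ = fork-span 0F 1F (λ ()) a∈P⁺ ca≡0 connL
    ; span₁ = join-span 0F 1F (λ ()) b∈P⁻ cb≡0 connL
    ; span₃ = join-span 1F 0F (λ ()) b′∈P⁻ cb′≡0 connM
    ; span₂ = fork-span 1F 0F (λ ()) a′∈P⁺ ca′≡0 connM
    ; fork-distinct = 1F-2F-distinct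
    ; join-distinct = 1F-2F-distinct
    }
    where
    1F-2F-distinct : Im {Fin 1} {Fin 3} (λ _ → 1F) ≐ Im {Fin 1} (λ _ → 2F) → ⊥
    1F-2F-distinct (⊆ , _) with ⊆ (0F , refl)
    ... | _ , ()

    -- Partiality comes from the other output `suc y` of the fork, an e-outport that this span
    -- leaves unglued.
    fork-span : ∀ {N q} (x y : Fin 2) → x ≢ y → q ∈ P⁺ N → (cq≡0 : c N q ≡ 0) →
                Connected N → PartiallySequentiable (point F (suc x) refl) (point N q cq≡0)
    fork-span x y x≢y q∈P⁺ cq≡0 conn = sequentiable ,
      inj₁ (Sequentiable.outports sequentiable , λ P⁻⊆ →
        let _ , _ , x≡y = P⁻⊆ {suc y} (λ ()) in x≢y (suc-injective x≡y))
      where sequentiable = points-sequentiable refl cq≡0 fork-connected conn (λ ()) q∈P⁺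

    -- Dually, the other input `suc y` of the join is an e-inport outside the image.
    join-span : ∀ {N q} (x y : Fin 2) → x ≢ y → q ∈ P⁻ N → (cq≡0 : c N q ≡ 0) →
                Connected N → PartiallySequentiable (point N q cq≡0) (point G (suc x) refl)
    join-span x y x≢y q∈P⁻ cq≡0 conn = sequentiable ,
      inj₂ (Sequentiable.inports sequentiable , λ P⁺⊆ →
        let _ , _ , x≡y = P⁺⊆ {suc y} (λ ()) in x≢y (suc-injective x≡y))
      where sequentiable = points-sequentiable cq≡0 refl conn join-connected q∈P⁻ (λ ())

  -- The synchronised computon.

  SyncU SyncP SyncI SyncO : Set
  SyncU = U L ⊎ U M ⊎ U F ⊎ U G
  SyncP = P L ⊎ P M ⊎ Fin 1 ⊎ Fin 1
  SyncI = I L ⊎ I M ⊎ I F ⊎ I G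
  SyncO = O L ⊎ O M ⊎ O F ⊎ O G

  -- This map carries all the identifications at the fork: it is the port component of the fork's
  -- leg, and `t′` and `s′` attach the fork's edges through it.
  forkPort : P F → SyncP
  forkPort 0F = in₃ 0F
  forkPort 1F = in₁ a
  forkPort 2F = in₂ a′

  joinPort : P G → SyncP
  joinPort 0F = in₄ 0F
  joinPort 1F = in₁ b
  joinPort 2F = in₂ b′

  σ′ : SyncO → SyncU
  σ′ = map (σ L) (map (σ M) (map (σ F) (σ G)))

  τ′ : SyncI → SyncU
  τ′ = map (τ L) (map (τ M) (map (τ F) (τ G)))

  t′ : SyncO → SyncP
  t′ = either (inj₁ ∘ t L) (either (inj₂ ∘ inj₁ ∘ t M) (either (forkPort ∘ t F) (joinPort ∘ t G)))

  s′ : SyncI → SyncP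
  s′ = either (inj₁ ∘ s L) (either (inj₂ ∘ inj₁ ∘ s M) (either (forkPort ∘ s F) (joinPort ∘ s G)))

  c′ : SyncP → ℕ
  c′ = either (c L) (either (c M) λ _ → 0)

  forkPort-colour : ∀ p → c′ (forkPort p) ≡ 0
  forkPort-colour 0F = refl
  forkPort-colour 1F = ca≡0
  forkPort-colour 2F = ca′≡0

  joinPort-colour : ∀ p → c′ (joinPort p) ≡ 0
  joinPort-colour 0F = refl
  joinPort-colour 1F = cb≡0
  joinPort-colour 2F = cb′≡0

  c′-colour : ∀ p → c′ p ∈ Colour L ∪ Colour M
  c′-colour (in₁ p) = inj₁ (c-colour L p)
  c′-colour (in₂ p) = inj₂ (c-colour M p)
  c′-colour (in₃ _) = inj₁ (0-colour L)
  c′-colour (in₄ _) = inj₁ (0-colour L)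

  c′-surjective : ∀ {k} → k ∈ Colour L ∪ Colour M → ∃[ p ] c′ p ≡ k
  c′-surjective (inj₁ k∈L) = let p , cp≡k = c-surjective L k∈L in in₁ p , cp≡k
  c′-surjective (inj₂ k∈M) = let p , cp≡k = c-surjective M k∈M in in₂ p , cp≡k

  σ′-surjective₀ : ∀ u → ∃[ o ] c′ (t′ o) ≡ 0 × σ′ o ≡ u
  σ′-surjective₀ (in₁ u)  = let o , ct≡0 , σo≡u = σ-surjective₀ L u in in₁ o , ct≡0 , cong inj₁ σo≡u
  σ′-surjective₀ (in₂ u)  =
    let o , ct≡0 , σo≡u = σ-surjective₀ M u in in₂ o , ct≡0 , cong (inj₂ ∘ inj₁) σo≡u
  -- Output edge 0 of the fork ends in port 1, which is glued to `a`, chosen of colour 0.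
  σ′-surjective₀ (in₃ 0F) = in₃ 0F , forkPort-colour 1F , refl
  σ′-surjective₀ (in₄ 0F) = in₄ 0F , joinPort-colour 0F , refl

  τ′-surjective₀ : ∀ u → ∃[ i ] c′ (s′ i) ≡ 0 × τ′ i ≡ u
  τ′-surjective₀ (in₁ u)  = let i , cs≡0 , τi≡u = τ-surjective₀ L u in in₁ i , cs≡0 , cong inj₁ τi≡u
  τ′-surjective₀ (in₂ u)  =
    let i , cs≡0 , τi≡u = τ-surjective₀ M u in in₂ i , cs≡0 , cong (inj₂ ∘ inj₁) τi≡u
  τ′-surjective₀ (in₃ 0F) = in₃ 0F , forkPort-colour 0F , refl
  τ′-surjective₀ (in₄ 0F) = in₄ 0F , joinPort-colour 1F , refl

  -- The fork now produces `a` and `a′`, so the colour-0 e-inport of `sync` is taken to be the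
  -- fork's input.
  fork-input∉Im-t′ : in₃ 0F ∉ Im t′
  fork-input∉Im-t′ (in₁ _ , ())
  fork-input∉Im-t′ (in₂ _ , ())
  fork-input∉Im-t′ (in₃ 0F , ())
  fork-input∉Im-t′ (in₃ 1F , ())
  fork-input∉Im-t′ (in₄ _ , ())

  -- The join now consumes `b` and `b′`, so the colour-0 e-outport of `sync` is taken to be the
  -- join's output.
  join-output∉Im-s′ : in₄ 0F ∉ Im s′
  join-output∉Im-s′ (in₁ _ , ())
  join-output∉Im-s′ (in₂ _ , ())
  join-output∉Im-s′ (in₃ _ , ())
  join-output∉Im-s′ (in₄ 0F , ())
  join-output∉Im-s′ (in₄ 1F , ())

  sync : Computon
  sync = record
    { U = SyncU ; P = SyncP ; I = SyncI ; O = SyncO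
    ; Colour = Colour L ∪ Colour M
    ; U-finite = ⊎-finite (U-finite L) (⊎-finite (U-finite M) (⊎-finite (U-finite F) (U-finite G)))
    ; P-finite = ⊎-finite (P-finite L) (⊎-finite (P-finite M) (⊎-finite Fin-finite Fin-finite))
    ; I-finite = ⊎-finite (I-finite L) (⊎-finite (I-finite M) (⊎-finite (I-finite F) (I-finite G)))
    ; O-finite = ⊎-finite (O-finite L) (⊎-finite (O-finite M) (⊎-finite (O-finite F) (O-finite G)))
    ; Colour-finite = ∪-finite (Colour-finite L) (Colour-finite M)
    ; P-nonempty = in₃ 0F
    ; 0-colour = inj₁ (0-colour L)
    ; σ = σ′ ; τ = τ′ ; t = t′ ; s = s′ ; c = c′
    ; c-colour = c′-colour
    ; σ-surjective = λ u → let o , _ , σo≡u = σ′-surjective₀ u in o , σo≡u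
    ; τ-surjective = λ u → let i , _ , τi≡u = τ′-surjective₀ u in i , τi≡u
    ; c-surjective = c′-surjective
    ; σ-surjective₀ = σ′-surjective₀
    ; τ-surjective₀ = τ′-surjective₀
    ; outport₀ = in₄ 0F , join-output∉Im-s′ , refl
    ; inport₀ = in₃ 0F , fork-input∉Im-t′ , refl
    }

  -- Legs of the cocone as computon morphisms.

  fromL : L ⇒ sync
  fromL = record { natural = η ; boundary = either (inj₁ ∘ i⃗⊆P⁺) (inj₂ ∘ o⃗⊆P⁻) }
    where
    η : L ⇒ⁿ sync
    η = record
      { onU = inj₁ ; onP = inj₁ ; onI = inj₁ ; onO = inj₁ ; inclusion = inj₁
      ; σ-natural = λ _ → refl ; τ-natural = λ _ → refl
      ; t-natural = λ _ → refl ; s-natural = λ _ → refl ; c-natural = λ _ → refl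
      }

    -- The only producer that gluing adds to a port of `L` is the fork, and it is added at `a`, an
    -- e-inport.
    i⃗⊆P⁺ : ∀ {p} → p ∈ i⃗ η → p ∈ P⁺ L
    -- An edge of `L` itself yields a producer already present in `L`, against `u∉`.
    i⃗⊆P⁺ (_ , (in₁ o , σo≡u , to≡p) , u∉) =
      ⊥-elim (u∉ (σ L o , (o , refl , inj₁-injective to≡p) , σo≡u))
    i⃗⊆P⁺ (_ , (in₃ 0F , _ , refl) , _) = a∈P⁺
    i⃗⊆P⁺ (_ , (in₃ 1F , _ , ()) , _)
    i⃗⊆P⁺ (_ , (in₄ _ , _ , ()) , _)

    -- The only added consumer is the join, and it is added at `b`, an e-outport.
    o⃗⊆P⁻ : ∀ {p} → p ∈ o⃗ η → p ∈ P⁻ L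
    o⃗⊆P⁻ (_ , (in₁ i , si≡p , τi≡u) , u∉) =
      ⊥-elim (u∉ (τ L i , (i , inj₁-injective si≡p , refl) , τi≡u))
    o⃗⊆P⁻ (_ , (in₃ _ , () , _) , _)
    o⃗⊆P⁻ (_ , (in₄ 0F , refl , _) , _) = b∈P⁻
    o⃗⊆P⁻ (_ , (in₄ 1F , () , _) , _)

  fromM : M ⇒ sync
  fromM = record { natural = η ; boundary = either (inj₁ ∘ i⃗⊆P⁺) (inj₂ ∘ o⃗⊆P⁻) }
    where
    η : M ⇒ⁿ sync
    η = record
      { onU = inj₂ ∘ inj₁ ; onP = inj₂ ∘ inj₁ ; onI = inj₂ ∘ inj₁ ; onO = inj₂ ∘ inj₁
      ; inclusion = inj₂
      ; σ-natural = λ _ → refl ; τ-natural = λ _ → refl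
      ; t-natural = λ _ → refl ; s-natural = λ _ → refl ; c-natural = λ _ → refl
      }

    i⃗⊆P⁺ : ∀ {p} → p ∈ i⃗ η → p ∈ P⁺ M
    i⃗⊆P⁺ (_ , (in₂ o , σo≡u , to≡p) , u∉) =
      ⊥-elim (u∉ (σ M o , (o , refl , inj₁-injective (inj₂-injective to≡p)) , σo≡u))
    i⃗⊆P⁺ (_ , (in₃ 0F , _ , ()) , _)
    -- Output edge 1 of the fork ends in port 2, the one glued to `a′`.
    i⃗⊆P⁺ (_ , (in₃ 1F , _ , refl) , _) = a′∈P⁺
    i⃗⊆P⁺ (_ , (in₄ _ , _ , ()) , _)

    o⃗⊆P⁻ : ∀ {p} → p ∈ o⃗ η → p ∈ P⁻ M
    o⃗⊆P⁻ (_ , (in₂ i , si≡p , τi≡u) , u∉) =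
      ⊥-elim (u∉ (τ M i , (i , inj₁-injective (inj₂-injective si≡p) , refl) , τi≡u))
    o⃗⊆P⁻ (_ , (in₃ _ , () , _) , _)
    o⃗⊆P⁻ (_ , (in₄ 0F , () , _) , _)
    o⃗⊆P⁻ (_ , (in₄ 1F , refl , _) , _) = b′∈P⁻

  fromFork : F ⇒ sync
  fromFork = record
    { natural = record
      { onU = inj₂ ∘ inj₂ ∘ inj₁ ; onP = forkPort
      ; onI = inj₂ ∘ inj₂ ∘ inj₁ ; onO = inj₂ ∘ inj₂ ∘ inj₁
      ; inclusion = λ { refl → inj₁ (0-colour L) }
      ; σ-natural = λ _ → refl ; τ-natural = λ _ → refl
      ; t-natural = λ _ → refl ; s-natural = λ _ → refl
      ; c-natural = λ p → sym (forkPort-colour p)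
      }
    ; boundary = λ _ → primitive-boundary {F} fork-primitive _
    }

  fromJoin : G ⇒ sync
  fromJoin = record
    { natural = record
      { onU = inj₂ ∘ inj₂ ∘ inj₂ ; onP = joinPort
      ; onI = inj₂ ∘ inj₂ ∘ inj₂ ; onO = inj₂ ∘ inj₂ ∘ inj₂
      ; inclusion = λ { refl → inj₁ (0-colour L) }
      ; σ-natural = λ _ → refl ; τ-natural = λ _ → refl
      ; t-natural = λ _ → refl ; s-natural = λ _ → refl
      ; c-natural = λ p → sym (joinPort-colour p)
      }
    ; boundary = λ _ → primitive-boundary {G} (opposite-primitive {F} fork-primitive) _
    }

  -- The universal property of the cocone.

  open Diagram (PDiagram.diagram ρ)

  legs : ∀ j → obj j ⇒ sync
  legs 0F = point sync (in₁ a) ca≡0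
  legs 1F = point sync (in₁ b) cb≡0
  legs 2F = point sync (in₂ a′) ca′≡0
  legs 3F = point sync (in₂ b′) cb′≡0
  legs 4F = fromL
  legs 5F = fromM
  legs 6F = fromFork
  legs 7F = fromJoin

  -- Unit computons have no computation units, so the cocone equations are vacuous and the colimit
  -- is a plain coproduct. The same holds for both kinds of edges.
  U-gluing : Gluing {pShape} (λ j → U (obj j)) (λ e → onU (natural (arr e))) SyncU
               (λ j → onU (natural (legs j)))
  U-gluing = record
    { cocone   = λ { 0F () ; 1F () ; 2F () ; 3F () ; 4F () ; 5F () ; 6F () ; 7F () }
    ; glue     = λ κ _ → either (κ 4F) (either (κ 5F) (either (κ 6F) (κ 7F)))
    ; glue-ι   = λ { _ _ 4F _ → refl ; _ _ 5F _ → refl ; _ _ 6F _ → refl ; _ _ 7F _ → refl }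
    ; covering = λ { (in₁ x) → 4F , x , refl ; (in₂ x) → 5F , x , refl
                   ; (in₃ x) → 6F , x , refl ; (in₄ x) → 7F , x , refl }
    }

  I-gluing : Gluing {pShape} (λ j → I (obj j)) (λ e → onI (natural (arr e))) SyncI
               (λ j → onI (natural (legs j)))
  I-gluing = record
    { cocone   = λ { 0F () ; 1F () ; 2F () ; 3F () ; 4F () ; 5F () ; 6F () ; 7F () }
    ; glue     = λ κ _ → either (κ 4F) (either (κ 5F) (either (κ 6F) (κ 7F)))
    ; glue-ι   = λ { _ _ 4F _ → refl ; _ _ 5F _ → refl ; _ _ 6F _ → refl ; _ _ 7F _ → refl }
    ; covering = λ { (in₁ x) → 4F , x , refl ; (in₂ x) → 5F , x , refl
                   ; (in₃ x) → 6F , x , refl ; (in₄ x) → 7F , x , refl }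
    }

  O-gluing : Gluing {pShape} (λ j → O (obj j)) (λ e → onO (natural (arr e))) SyncO
               (λ j → onO (natural (legs j)))
  O-gluing = record
    { cocone   = λ { 0F () ; 1F () ; 2F () ; 3F () ; 4F () ; 5F () ; 6F () ; 7F () }
    ; glue     = λ κ _ → either (κ 4F) (either (κ 5F) (either (κ 6F) (κ 7F)))
    ; glue-ι   = λ { _ _ 4F _ → refl ; _ _ 5F _ → refl ; _ _ 6F _ → refl ; _ _ 7F _ → refl }
    ; covering = λ { (in₁ x) → 4F , x , refl ; (in₂ x) → 5F , x , refl
                   ; (in₃ x) → 6F , x , refl ; (in₄ x) → 7F , x , refl }
    }

  P-gluing : Gluing {pShape} (λ j → P (obj j)) (λ e → onP (natural (arr e))) SyncP
               (λ j → onP (natural (legs j)))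
  P-gluing = record
    { cocone   = λ { 0F _ → refl ; 1F _ → refl ; 2F _ → refl ; 3F _ → refl
                   ; 4F _ → refl ; 5F _ → refl ; 6F _ → refl ; 7F _ → refl }
    -- Glued ports take their values from `κ 4F` and `κ 5F`; the fork and the join contribute only
    -- their unglued port 0.
    ; glue     = λ κ _ → either (κ 4F) (either (κ 5F) (either (λ _ → κ 6F 0F) (λ _ → κ 7F 0F)))
    ; glue-ι   = λ
      { _ κ-cocone 0F 0F → κ-cocone 0F 0F
      ; _ κ-cocone 1F 0F → κ-cocone 1F 0F
      ; _ κ-cocone 2F 0F → κ-cocone 6F 0F
      ; _ κ-cocone 3F 0F → κ-cocone 7F 0F
      ; _ _ 4F _ → refl
      ; _ _ 5F _ → refl
      ; _ _ 6F 0F → refl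
      -- The values at `a` and at port 1 of the fork agree, since both equal the value of `κ 0F`, by
      -- the cocone equations for `α₀` and `α₂`.
      ; _ κ-cocone 6F 1F → trans (κ-cocone 0F 0F) (sym (κ-cocone 2F 0F))
      ; _ κ-cocone 6F 2F → trans (κ-cocone 6F 0F) (sym (κ-cocone 4F 0F))
      ; _ _ 7F 0F → refl
      ; _ κ-cocone 7F 1F → trans (κ-cocone 1F 0F) (sym (κ-cocone 3F 0F))
      ; _ κ-cocone 7F 2F → trans (κ-cocone 7F 0F) (sym (κ-cocone 5F 0F))
      }
    ; covering = λ { (in₁ x) → 4F , x , refl ; (in₂ x) → 5F , x , refl
                   ; (in₃ 0F) → 6F , 0F , refl ; (in₄ 0F) → 7F , 0F , refl }
    }

  colimit : PSync ρ
  colimit = record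
    { apex      = sync
    ; legs      = legs
    ; isColimit = componentwise (PDiagram.diagram ρ) sync legs U-gluing P-gluing I-gluing O-gluing
        -- For the converse, the legs already include the colours of every node in those of `sync`.
        ( either (4F ,_) (5F ,_)
        , λ (j , k∈j) → inclusion (natural (legs j)) k∈j )
    }

theorem3 : (L₁ L₂ : Computon) → Connected L₁ → Connected L₂ →
    Σ[ ρ ∈ PDiagram L₁ L₂ ] PSync ρ
theorem3 L₁ L₂ connected₁ connected₂ = ρ , colimit
  where open Parallel L₁ L₂ connected₁ connected₂
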